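{- Let $G(V,E)$ be a graph. If there is a vertex $v\in V$ with degree $d(v)=\frac{|E|}{2}$, then $G$ is balanceable.
   Context: All graphs are simple and finite. A 2-coloring of the edges of $K_n$ is a function $\alpha:E(K_n)\to\{R,B\}$. It contains a balanced copy of a graph $G$ if $K_n$ has a (not necessarily induced) subgraph isomorphic to $G$ whose edge set is partitioned into $E_1,E_2$ with $\alpha(e)=R$ for $e\in E_1$, $\alpha(e)=B$ for $e\in E_2$, and $\big||E_1|-|E_2|\big|\le 1$. A graph $G$ is balanceable if there is an $n_0$ such that for every $n\ge n_0$ there exists an integer $m$ with $0\le m<\lfloor \frac12\binom n2\rfloor$ such that every 2-coloring $\alpha$ of $E(K_n)$ with $|\alpha^{ -1}(R)|>m$ and $|\alpha^{ -1}(B)|>m$ contains a balanced copy of $G$. -}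

module Defs where

open import Data.Fin using (Fin; _<?_)
open import Data.Fin.Properties using (_≟_)
open import Data.List using (List; allFin; cartesianProduct; filter; length)
open import Data.Nat using (ℕ; _≤_; _<_; _>_; _≥_; ∣_-_∣; ⌊_/2⌋)
open import Data.Nat.Combinatorics using (_C_)
open import Data.Product using (_×_; _,_; ∃-syntax; Σ-syntax)
open import Function.Definitions using (Injective)
open import Level using (0ℓ)
open import Relation.Binary using (Rel; Decidable; DecidableEquality; Symmetric; Irreflexive)
open import Relation.Binary.PropositionalEquality using (_≡_; _≢_; refl; ≢-sym)
open import Relation.Nullary using (yes; no; ¬?; _×-dec_)

-- Finite simple graphs with vertex set {0, …, n - 1}.
record Graph (n : ℕ) : Set₁ where
  field
    Adj    : Rel (Fin n) 0ℓ
    adj?   : Decidable Adj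
    symm   : Symmetric Adj
    irrefl : Irreflexive _≡_ Adj

open Graph public

-- Each edge is listed once, with its smaller endpoint first.
edges : ∀ {n} → Graph n → List (Fin n × Fin n)
edges {n} G =
  filter (λ (i , j) → (i <? j) ×-dec adj? G i j)
         (cartesianProduct (allFin n) (allFin n))

size : ∀ {n} → Graph n → ℕ
size G = length (edges G)

degree : ∀ {n} → Graph n → Fin n → ℕ
degree {n} G v = length (filter (adj? G v) (allFin n))

complete : ∀ n → Graph n
complete n = record
  { Adj    = _≢_
  ; adj?   = λ i j → ¬? (i ≟ j)
  ; symm   = ≢-sym
  ; irrefl = λ i≡j i≢j → i≢j i≡j
  }

-- A subgraph of H isomorphic to G (not necessarily induced), given by the
-- isomorphism from G onto it: its edges are the pairs {embed i , embed j}
-- with {i , j} an edge of G.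
record Copy {k n} (G : Graph k) (H : Graph n) : Set where
  field
    embed     : Fin k → Fin n
    injective : Injective _≡_ _≡_ embed
    preserves : ∀ {i j} → Adj G i j → Adj H (embed i) (embed j)

open Copy public

data Colour : Set where
  R B : Colour

_≟ᶜ_ : DecidableEquality Colour
R ≟ᶜ R = yes refl
R ≟ᶜ B = no λ ()
B ≟ᶜ R = no λ ()
B ≟ᶜ B = yes refl

-- A 2-colouring of the edges of the complete graph on Fin n, as a symmetric
-- function of the two endpoints.  Diagonal values are never used: colours are
-- only ever read off at edges.
record Colouring (n : ℕ) : Set where
  field
    colour      : Fin n → Fin n → Colour
    colour-symm : ∀ i j → colour i j ≡ colour j i

open Colouring public

-- | α⁻¹(c) |
classSize : ∀ {n} → Colouring n → Colour → ℕ
classSize {n} α c =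
  length (filter (λ (i , j) → colour α i j ≟ᶜ c) (edges (complete n)))

-- The number of edges of the copy that have colour c.  By injectivity and
-- preservation, the edges of the copy correspond bijectively to those of G.
copyClassSize : ∀ {k n} {G : Graph k} →
                Colouring n → Copy G (complete n) → Colour → ℕ
copyClassSize {G = G} α H c =
  length (filter (λ (i , j) → colour α (embed H i) (embed H j) ≟ᶜ c) (edges G))

Balanced : ∀ {k n} {G : Graph k} → Colouring n → Copy G (complete n) → Set
Balanced α H = ∣ copyClassSize α H R - copyClassSize α H B ∣ ≤ 1

ContainsBalancedCopy : ∀ {k n} → Graph k → Colouring n → Set
ContainsBalancedCopy {n = n} G α = Σ[ H ∈ Copy G (complete n) ] Balanced α H

Balanceable : ∀ {k} → Graph k → Set
Balanceable G =
  ∃[ n₀ ] ∀ n → n ≥ n₀ →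
  ∃[ m ] m < ⌊ n C 2 /2⌋ ×
    (∀ (α : Colouring n) → classSize α R > m → classSize α B > m →
     ContainsBalancedCopy G α)

{-# OPTIONS --safe #-}

-- Call a vertex c-rich if it meets more than r edges of colour c, where r is a
-- large Ramsey number.  With m = 3rn, both colour classes having more than m
-- edges forces many rich vertices of either colour, and double counting the
-- pairs between the R-rich and the B-rich ones yields a vertex x that is rich
-- in both colours.  Ramsey's theorem gives large monochromatic cliques in both
-- colour neighbourhoods of x.  If the clique has the colour opposite to its
-- edges to x, then x is its hub; otherwise we have an R-clique and a disjoint
-- B-clique, and double counting the edges between them gives a vertex of one
-- clique joined to many vertices of the other by edges of the colour that this
-- other clique does not have.  So there is always a monochromatic clique all of
-- whose edges to some hub have the other colour.  Placing v at the hub and the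
-- rest of G in the clique gives the d(v) = |E|/2 edges at v one colour, and the
-- other |E|/2 edges the other.
module Submission where

open import Data.Nat using (ℕ; _*_)
open import Data.Fin using (Fin)
open import Data.Product using (∃-syntax)
open import Relation.Binary.PropositionalEquality using (_≡_)
open import Defs

open import Data.Bool using (true; false)
open import Data.Empty using (⊥-elim)
open import Data.Fin using (zero; suc; punchOut; inject≤)
  renaming (_<_ to _<ᶠ_; _<?_ to _<?ᶠ_)
open import Data.Fin.Properties using (_≟_; punchOut-injective; inject≤-injective; injective⇒≤)
  renaming (<-irrefl to <ᶠ-irrefl; <-asym to <ᶠ-asym; <-cmp to <ᶠ-cmp)
open import Data.List using (List; []; _∷_; length; lookup; map; filter; allFin; cartesianProduct)
open import Data.List.Properties
  using (length-++; length-map; length-tabulate; length-filter; filter-++; filter-none)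
open import Data.List.Membership.Propositional using (_∈_; find)
open import Data.List.Membership.Propositional.Properties
  using (∈-lookup; ∈-allFin; ∈-filter⁺; ∈-filter⁻; ∈-map⁺; ∈-map⁻; ∈-cartesianProduct⁺)
open import Data.List.Relation.Binary.Subset.Propositional using (_⊆_)
open import Data.List.Relation.Binary.Subset.Propositional.Properties
  using (filter-⊆; filter⁺′; ⊆-trans)
open import Data.List.Relation.Unary.All as All using (All; []; _∷_)
open import Data.List.Relation.Unary.All.Properties using (¬Any⇒All¬)
open import Data.List.Relation.Unary.AllPairs using (AllPairs; []; _∷_)
import Data.List.Relation.Unary.AllPairs.Properties as AllPairs
open import Data.List.Relation.Unary.Any as Any using (here; there; any?)
open import Data.List.Relation.Unary.Any.Properties using (lookup-index)
open import Data.List.Relation.Unary.Unique.Propositional using (Unique)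
import Data.List.Relation.Unary.Unique.Propositional.Properties as Unique
open import Data.Nat
  using (zero; suc; _+_; _≤_; _<_; _≥_; _≤?_; _<?_; z≤n; s≤s; s≤s⁻¹; ⌊_/2⌋; NonZero; >-nonZero)
open import Data.Nat.Combinatorics using (_C_; nCk+nC[k+1]≡[n+1]C[k+1]; nC1≡n)
open import Data.Nat.ListAction using (sum)
open import Data.Nat.Properties hiding (_≟_)
open import Algebra.Properties.CommutativeSemigroup
  +-commutativeSemigroup using (interchange; x∙yz≈y∙xz)
open import Data.Nat.Tactic.RingSolver using (solve-∀)
open import Data.Product using (_×_; _,_; proj₁; proj₂)
open import Data.Sum using (_⊎_; inj₁; inj₂)
open import Function using (_∘_; id)
open import Level using (Level; 0ℓ)
open import Relation.Binary using (Rel; Symmetric; tri<; tri≈; tri>)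
open import Relation.Binary.PropositionalEquality
  using (_≢_; refl; sym; trans; cong; cong₂; subst; ≢-sym; module ≡-Reasoning)
open import Relation.Nullary using (¬_; does; yes; no; ¬?; contradiction; _×-dec_)
open import Relation.Unary using (Pred; Decidable)

private
  variable
    a ℓ : Level
    A A′ : Set a
    n : ℕ

-- Inequalities, lists and sums over lists.

+-≤-split : ∀ {a b} c d → a + b ≤ c + d → a ≤ c ⊎ b ≤ d
+-≤-split {a} {b} c d le with a ≤? c | b ≤? d
... | yes a≤c | _       = inj₁ a≤c
... | no _    | yes b≤d = inj₂ b≤d
... | no a≰c  | no b≰d  = contradiction le (<⇒≱ (+-mono-< (≰⇒> a≰c) (≰⇒> b≰d)))

equal-halves : ∀ {a b d} → a + b ≡ d + d → a ≡ d ⊎ b ≡ d → a ≡ b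
equal-halves {d = d} eq (inj₁ refl) = sym (+-cancelˡ-≡ d _ _ eq)
equal-halves {d = d} eq (inj₂ refl) = +-cancelʳ-≡ d _ _ eq

lookup-AllPairs : {R : Rel A ℓ} → Symmetric R → ∀ {xs} → AllPairs R xs →
                  ∀ {i j} → i ≢ j → R (lookup xs i) (lookup xs j)
lookup-AllPairs s (r ∷ rs) {zero}  {zero}  i≢j = contradiction refl i≢j
lookup-AllPairs s (r ∷ rs) {zero}  {suc j} i≢j = All.lookup r (∈-lookup j)
lookup-AllPairs s (r ∷ rs) {suc i} {zero}  i≢j = s (All.lookup r (∈-lookup i))
lookup-AllPairs s (r ∷ rs) {suc i} {suc j} i≢j = lookup-AllPairs s rs (i≢j ∘ cong suc)

-- Pigeonhole: sending each index of `xs` to that of an occurrence of the same entry in `ys` is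
-- injective, because `xs` has no repetitions.
⊆⇒length≤ : {xs ys : List A} → Unique xs → xs ⊆ ys → length xs ≤ length ys
⊆⇒length≤ {xs = xs} {ys} xs! xs⊆ys = injective⇒≤ {f = position} position-injective
  where
  position : Fin (length xs) → Fin (length ys)
  position i = Any.index (xs⊆ys (∈-lookup i))

  lookup-position : ∀ i → lookup xs i ≡ lookup ys (position i)
  lookup-position i = lookup-index (xs⊆ys (∈-lookup i))

  position-injective : ∀ {i j} → position i ≡ position j → i ≡ j
  position-injective {i} {j} eq with i ≟ j
  ... | yes i≡j = i≡j
  ... | no  i≢j = contradiction
    (trans (lookup-position i) (trans (cong (lookup ys) eq) (sym (lookup-position j))))
    (lookup-AllPairs ≢-sym xs! i≢j)

length-filter-map : {P : Pred A′ ℓ} (P? : Decidable P) (f : A → A′) → ∀ xs →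
                    length (filter P? (map f xs)) ≡ length (filter (P? ∘ f) xs)
length-filter-map P? f []       = refl
length-filter-map P? f (x ∷ xs) with does (P? (f x))
... | true  = cong suc (length-filter-map P? f xs)
... | false = length-filter-map P? f xs

length-filter-cartesianProduct :
  {P : Pred (A × A′) ℓ} (P? : Decidable P) → ∀ xs ys →
  length (filter P? (cartesianProduct xs ys)) ≡
  sum (map (λ x → length (filter (λ y → P? (x , y)) ys)) xs)
length-filter-cartesianProduct P? []       ys = refl
length-filter-cartesianProduct P? (x ∷ xs) ys = trans
  (cong length (filter-++ P? (map (x ,_) ys) (cartesianProduct xs ys)))
  (trans (length-++ (filter P? (map (x ,_) ys)))
         (cong₂ _+_ (length-filter-map P? (x ,_) ys) (length-filter-cartesianProduct P? xs ys)))

sum-map-≤ : ∀ {P : Pred A ℓ} (P? : Decidable P) (f : A → ℕ) {r u} →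
            (∀ {x} → ¬ P x → f x ≤ r) → (∀ x → f x ≤ u) → ∀ xs →
            sum (map f xs) ≤ length xs * r + length (filter P? xs) * u
sum-map-≤ P? f         f≤r f≤u []       = z≤n
sum-map-≤ P? f {r} {u} f≤r f≤u (x ∷ xs) with P? x
... | yes _   = begin
  f x + sum (map f xs)        ≤⟨ +-mono-≤ (f≤u x) (sum-map-≤ P? f f≤r f≤u xs) ⟩
  u + (l * r + h * u)         ≤⟨ m≤n+m _ r ⟩
  r + (u + (l * r + h * u))   ≡⟨ shuffle r u (l * r) (h * u) ⟩
  r + l * r + (u + h * u)     ∎
  where
  open ≤-Reasoning
  l = length xs
  h = length (filter P? xs)
  shuffle : ∀ a b c d → a + (b + (c + d)) ≡ a + c + (b + d)
  shuffle = solve-∀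
... | no ¬px = begin
  f x + sum (map f xs)        ≤⟨ +-mono-≤ (f≤r ¬px) (sum-map-≤ P? f f≤r f≤u xs) ⟩
  r + (l * r + h * u)         ≡⟨ +-assoc r _ _ ⟨
  r + l * r + h * u           ∎
  where
  open ≤-Reasoning
  l = length xs
  h = length (filter P? xs)

length-by-colour : ∀ (f : A → Colour) xs →
  length (filter (λ x → f x ≟ᶜ R) xs) + length (filter (λ x → f x ≟ᶜ B) xs) ≡ length xs
length-by-colour f []       = refl
length-by-colour f (x ∷ xs) with f x
... | R = cong suc (length-by-colour f xs)
... | B = trans (+-suc _ _) (cong suc (length-by-colour f xs))

-- Colour degrees and double counting.

module _ (α : Colouring n) where

  neighbours : Colour → Fin n → List (Fin n) → List (Fin n)
  neighbours c x = filter (λ y → colour α x y ≟ᶜ c)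

  -- The degree of x in colour c into a list, counting x itself when it is listed
  -- and the (meaningless) diagonal value of α happens to be c.
  count : Colour → Fin n → List (Fin n) → ℕ
  count c x ys = length (neighbours c x ys)

  count-mono : ∀ c x {ys zs} → Unique ys → ys ⊆ zs → count c x ys ≤ count c x zs
  count-mono c x ys! ys⊆zs = ⊆⇒length≤ (Unique.filter⁺ _ ys!) (filter⁺′ _ _ id ys⊆zs)

  -- A new entry `x` raises the count at `y` by one exactly when the colour at `y`, `x` is `c`; by
  -- `colour-symm` these `y` are the ones that `count c x ys` counts.
  sum-count-∷ : ∀ c x xs ys →
    count c x ys + sum (map (λ y → count c y xs) ys) ≡
    sum (map (λ y → count c y (x ∷ xs)) ys)
  sum-count-∷ c x xs []       = refl
  sum-count-∷ c x xs (y ∷ ys)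
    rewrite sym (sum-count-∷ c x xs ys) | colour-symm α y x with does (colour α x y ≟ᶜ c)
  ... | true  = cong suc (x∙yz≈y∙xz (count c x ys) (count c y xs) _)
  ... | false = x∙yz≈y∙xz (count c x ys) (count c y xs) _

  -- Each pair is either R, and counted from its entry in `xs`, or B, and counted from its entry in
  -- `ys`. The lists may overlap: diagonal pairs have a colour too.
  length*length≤ : ∀ xs ys → length xs * length ys ≤
    sum (map (λ x → count R x ys) xs) + sum (map (λ y → count B y xs) ys)
  length*length≤ []       ys = z≤n
  length*length≤ (x ∷ xs) ys = begin
    length ys + length xs * length ys
      ≤⟨ +-mono-≤ (≤-reflexive (sym (length-by-colour (colour α x) ys))) (length*length≤ xs ys) ⟩
    (count R x ys + count B x ys) + (sR + sum (map (λ y → count B y xs) ys))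
      ≡⟨ interchange (count R x ys) (count B x ys) sR _ ⟩
    (count R x ys + sR) + (count B x ys + sum (map (λ y → count B y xs) ys))
      ≡⟨ cong (count R x ys + sR +_) (sum-count-∷ B x xs ys) ⟩
    (count R x ys + sR) + sum (map (λ y → count B y (x ∷ xs)) ys) ∎
    where
    open ≤-Reasoning
    sR = sum (map (λ x → count R x ys) xs)

  -- Otherwise all counts are at most `r`, and double counting gives `p * q ≤ p * r + q * r` for the
  -- lengths `p` and `q`. But `2 * r` lies below both lengths, so the right side is smaller than
  -- `p * q`.
  cross : ∀ r xs ys → 2 * r < length xs → 2 * r < length ys →
          (∃[ x ] x ∈ xs × r < count R x ys) ⊎ (∃[ y ] y ∈ ys × r < count B y xs)
  cross r xs ys 2r<p 2r<q
    with any? (λ x → r <? count R x ys) xs | any? (λ y → r <? count B y xs) ys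
  ... | yes found | _         = inj₁ (find found)
  ... | no _      | yes found = inj₂ (find found)
  ... | no noneR  | no noneB  = ⊥-elim (<-irrefl refl (begin-strict
    2 * (p * q)                   ≤⟨ *-monoʳ-≤ 2 (length*length≤ xs ys) ⟩
    2 * (sum (map (λ x → count R x ys) xs) + sum (map (λ y → count B y xs) ys))
                                  ≤⟨ *-monoʳ-≤ 2 (+-mono-≤ (sum≤ R ys xs noneR) (sum≤ B xs ys noneB)) ⟩
    2 * (p * r + q * r)           ≡⟨ shuffle p q r ⟩
    p * (2 * r) + q * (2 * r)     <⟨ +-mono-≤-< (*-monoʳ-≤ p (<⇒≤ 2r<q)) (*-monoʳ-< q ⦃ q≢0 ⦄ 2r<p) ⟩
    p * q + q * p                 ≡⟨ cong (p * q +_) (trans (*-comm q p) (sym (+-identityʳ _))) ⟩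
    2 * (p * q)                   ∎))
    where
    open ≤-Reasoning
    p = length xs
    q = length ys
    q≢0 : NonZero q
    q≢0 = >-nonZero (≤-<-trans z≤n 2r<q)
    shuffle : ∀ p q r → 2 * (p * r + q * r) ≡ p * (2 * r) + q * (2 * r)
    shuffle = solve-∀
    sum≤ : ∀ c ys xs → ¬ Any.Any (λ x → r < count c x ys) xs →
           sum (map (λ x → count c x ys) xs) ≤ length xs * r
    sum≤ c ys xs none = begin
      sum (map (λ x → count c x ys) xs)
        ≤⟨ sum-map-≤ (λ x → r <? count c x ys) (λ x → count c x ys) ≮⇒≥ (λ x → length-filter _ ys) xs ⟩
      length xs * r + length (filter (λ x → r <? count c x ys) xs) * length ys
        ≡⟨ cong (λ l → length xs * r + length l * length ys) (filter-none _ (¬Any⇒All¬ xs none)) ⟩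
      length xs * r + 0
        ≡⟨ +-identityʳ _ ⟩
      length xs * r ∎

  rich : ℕ → Colour → List (Fin n)
  rich r c = filter (λ x → r <? count c x (allFin n)) (allFin n)

  rich! : ∀ r c → Unique (rich r c)
  rich! r c = Unique.filter⁺ _ (Unique.allFin⁺ n)

  -- Dropping the conditions on `i` and `j` bounds the class by a sum of colour degrees, each at
  -- most `r` at a vertex that is not rich and at most `n` elsewhere.
  classSize-≤ : ∀ r c → classSize α c ≤ n * r + length (rich r c) * n
  classSize-≤ r c = begin
    classSize α c
      ≤⟨ ⊆⇒length≤ (Unique.filter⁺ _ (Unique.filter⁺ _ pairs!)) (filter⁺′ _ _ id (filter-⊆ _ pairs)) ⟩
    length (filter (λ (i , j) → colour α i j ≟ᶜ c) pairs)
      ≡⟨ length-filter-cartesianProduct (λ (i , j) → colour α i j ≟ᶜ c) (allFin n) (allFin n) ⟩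
    sum (map (λ x → count c x (allFin n)) (allFin n))
      ≤⟨ sum-map-≤ (λ x → r <? count c x (allFin n)) (λ x → count c x (allFin n)) ≮⇒≥
           (λ x → ≤-trans (length-filter _ (allFin n)) (≤-reflexive length-allFin)) (allFin n) ⟩
    length (allFin n) * r + length (rich r c) * n
      ≡⟨ cong (λ l → l * r + length (rich r c) * n) length-allFin ⟩
    n * r + length (rich r c) * n ∎
    where
    open ≤-Reasoning
    pairs = cartesianProduct (allFin n) (allFin n)
    pairs! = Unique.cartesianProduct⁺ (Unique.allFin⁺ n) (Unique.allFin⁺ n)
    length-allFin : length (allFin n) ≡ n
    length-allFin = length-tabulate id

  -- At most `2 * r` rich vertices, too few for `cross`, would allow only `n * r + (2 * r) * n`
  -- edges; this is the origin of `m`.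
  many-rich : ∀ r c → n * r + (2 * r) * n < classSize α c → 2 * r < length (rich r c)
  many-rich r c large with 2 * r <? length (rich r c)
  ... | yes lt = lt
  ... | no  ge = contradiction
    (≤-trans (classSize-≤ r c) (+-monoʳ-≤ (n * r) (*-monoˡ-≤ n (≮⇒≥ ge)))) (<⇒≱ large)

  rich-in-both : ∀ r → n * r + (2 * r) * n < classSize α R → n * r + (2 * r) * n < classSize α B →
                 ∃[ x ] (∀ c → r < count c x (allFin n))
  rich-in-both r largeR largeB
    -- The B-rich list goes first because `cross` counts R from its first list: either outcome is a
    -- vertex rich in one colour whose count in the other exceeds `r`.
    with cross r (rich r B) (rich r R) (many-rich r B largeB) (many-rich r R largeR)
  ... | inj₁ (x , x∈ , lt) = x , λ where
    R → <-≤-trans lt (count-mono R x (rich! r R) (filter-⊆ _ (allFin n)))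
    B → proj₂ (∈-filter⁻ _ {xs = allFin n} x∈)
  ... | inj₂ (x , x∈ , lt) = x , λ where
    R → proj₂ (∈-filter⁻ _ {xs = allFin n} x∈)
    B → <-≤-trans lt (count-mono B x (rich! r B) (filter-⊆ _ (allFin n)))

  -- Colour neighbourhoods and Ramsey's theorem.

  nbhd : Colour → Fin n → List (Fin n)
  nbhd c x = filter (λ y → ¬? (x ≟ y)) (neighbours c x (allFin n))

  nbhd! : ∀ c x → Unique (nbhd c x)
  nbhd! c x = Unique.filter⁺ _ (Unique.filter⁺ _ (Unique.allFin⁺ n))

  ∈-nbhd⁻ : ∀ {c x y} → y ∈ nbhd c x → x ≢ y × colour α x y ≡ c
  ∈-nbhd⁻ {c} {x} y∈ with ∈-filter⁻ (λ y → ¬? (x ≟ y)) {xs = neighbours c x (allFin n)} y∈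
  ... | y∈′ , x≢y = x≢y , proj₂ (∈-filter⁻ (λ y → colour α x y ≟ᶜ c) {xs = allFin n} y∈′)

  count≤1+nbhd : ∀ c x → count c x (allFin n) ≤ suc (length (nbhd c x))
  count≤1+nbhd c x = ⊆⇒length≤ {ys = x ∷ nbhd c x} (Unique.filter⁺ _ (Unique.allFin⁺ n)) sub
    where
    sub : neighbours c x (allFin n) ⊆ x ∷ nbhd c x
    sub {y} y∈ with x ≟ y
    ... | yes x≡y = here (sym x≡y)
    ... | no  x≢y = there (∈-filter⁺ (λ y → ¬? (x ≟ y)) y∈ x≢y)

  Clique : Colour → List (Fin n) → Set
  Clique c = AllPairs (λ x y → x ≢ y × colour α x y ≡ c)

  CliqueIn : Colour → ℕ → List (Fin n) → Set
  CliqueIn c s L = ∃[ S ] S ⊆ L × s ≤ length S × Clique c S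

  CliqueIn-neighbours : ∀ {c d s x L} → CliqueIn c s (neighbours d x L) → CliqueIn c s L
  CliqueIn-neighbours (S , S⊆ , s≤ , cl) = S , ⊆-trans S⊆ (filter-⊆ _ _) , s≤ , cl

  CliqueIn-∷ : ∀ {c s x L} → CliqueIn c s L → CliqueIn c s (x ∷ L)
  CliqueIn-∷ (S , S⊆ , s≤ , cl) = S , there ∘ S⊆ , s≤ , cl

  CliqueIn-insert : ∀ {c s x L} → All (x ≢_) L →
                    CliqueIn c s (neighbours c x L) → CliqueIn c (suc s) (x ∷ L)
  CliqueIn-insert {c} {s} {x} {L} x∉L (S , S⊆ , s≤ , cl) =
    x ∷ S , sub , s≤s s≤ , All.tabulate joined ∷ cl
    where
    sub : x ∷ S ⊆ x ∷ L
    sub (here eq)  = here eq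
    sub (there y∈) = there (filter-⊆ _ _ (S⊆ y∈))

    joined : ∀ {y} → y ∈ S → x ≢ y × colour α x y ≡ c
    joined y∈ with ∈-filter⁻ (λ y → colour α x y ≟ᶜ c) {xs = L} (S⊆ y∈)
    ... | y∈L , eq = All.lookup x∉L y∈L , eq

-- The Erdős-Szekeres recursion: one chosen vertex, plus enough others to make one of its colour
-- neighbourhoods large enough for a smaller case.
ramseyBound : ℕ → ℕ → ℕ
ramseyBound zero    t       = 0
ramseyBound (suc s) zero    = 0
ramseyBound (suc s) (suc t) = suc (ramseyBound s (suc t) + ramseyBound (suc s) t)

module _ (α : Colouring n) where

  -- Split the tail by colour to the head `x`; one part reaches its bound. Recursing there yields
  -- either a clique one short in the colour of its edges to `x`, which `x` completes, or a full
  -- clique of the other colour.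
  ramsey : ∀ s t L → Unique L → ramseyBound s t ≤ length L → CliqueIn α R s L ⊎ CliqueIn α B t L
  ramsey zero    t       L       _          _        = inj₁ ([] , (λ ()) , z≤n , [])
  ramsey (suc s) zero    L       _          _        = inj₂ ([] , (λ ()) , z≤n , [])
  ramsey (suc s) (suc t) (x ∷ L) (x∉L ∷ L!) (s≤s le)
    with +-≤-split (count α R x L) (count α B x L)
           (≤-trans le (≤-reflexive (sym (length-by-colour (colour α x) L))))
  ... | inj₁ leR with ramsey s (suc t) (neighbours α R x L) (Unique.filter⁺ _ L!) leR
  ...   | inj₁ cl = inj₁ (CliqueIn-insert α x∉L cl)
  ...   | inj₂ cl = inj₂ (CliqueIn-∷ α (CliqueIn-neighbours α {d = R} {x = x} cl))
  ramsey (suc s) (suc t) (x ∷ L) (x∉L ∷ L!) (s≤s le)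
      | inj₂ leB with ramsey (suc s) t (neighbours α B x L) (Unique.filter⁺ _ L!) leB
  ...   | inj₁ cl = inj₁ (CliqueIn-∷ α (CliqueIn-neighbours α {d = B} {x = x} cl))
  ...   | inj₂ cl = inj₂ (CliqueIn-insert α x∉L cl)

-- Finding a fan.

record Fan (α : Colouring n) (q : ℕ) : Set where
  field
    rimColour spokeColour : Colour
    distinct : rimColour ≢ spokeColour
    hub      : Fin n
    rim      : List (Fin n)
    large    : q ≤ length rim
    clique   : Clique α rimColour rim
    spokes   : ∀ {y} → y ∈ rim → hub ≢ y × colour α hub y ≡ spokeColour

-- `suc (2 * q)` is the length that `cross` demands of both cliques to leave more than `q` spokes.
threshold : ℕ → ℕ
threshold q = ramseyBound (suc (2 * q)) (suc (2 * q))

module _ (α : Colouring n) where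

  nbhd-disjoint : ∀ {x y z} → y ∈ nbhd α R x → z ∈ nbhd α B x → y ≢ z
  nbhd-disjoint y∈ z∈ refl with trans (sym (proj₂ (∈-nbhd⁻ α y∈))) (proj₂ (∈-nbhd⁻ α z∈))
  ... | ()

  fan-at-rich : ∀ q x → (∀ c → threshold q < count α c x (allFin n)) → Fan α q
  fan-at-rich q x rich = by-cliques (clique-near R) (clique-near B)
    where
    q≤ : ∀ {l} → suc (2 * q) ≤ l → q ≤ l
    q≤ = ≤-trans (≤-trans (m≤m+n q _) (n≤1+n _))

    clique-near : ∀ c → CliqueIn α R (suc (2 * q)) (nbhd α c x) ⊎
                        CliqueIn α B (suc (2 * q)) (nbhd α c x)
    -- The strict inequality in `rich` pays for `x`, which `nbhd` leaves out.
    clique-near c = ramsey α _ _ (nbhd α c x) (nbhd! α c x)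
      (s≤s⁻¹ (≤-trans (rich c) (count≤1+nbhd α c x)))

    by-cliques : CliqueIn α R (suc (2 * q)) (nbhd α R x) ⊎ CliqueIn α B (suc (2 * q)) (nbhd α R x) →
                 CliqueIn α R (suc (2 * q)) (nbhd α B x) ⊎ CliqueIn α B (suc (2 * q)) (nbhd α B x) →
                 Fan α q
    by-cliques (inj₂ (S , S⊆ , large , cl)) _ = record
      { distinct = λ (); hub = x; rim = S; large = q≤ large; clique = cl; spokes = ∈-nbhd⁻ α ∘ S⊆ }
    by-cliques (inj₁ _) (inj₁ (T , T⊆ , large , cl)) = record
      { distinct = λ (); hub = x; rim = T; large = q≤ large; clique = cl; spokes = ∈-nbhd⁻ α ∘ T⊆ }
    by-cliques (inj₁ (S , S⊆ , largeS , clS)) (inj₂ (T , T⊆ , largeT , clT))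
      with cross α q S T largeS largeT
    -- Here `y` has more than `q` R-edges into the B-clique `T`, and the part of `T` they reach is
    -- still a B-clique. The hub is off the rim because `S` and `T` are joined to `x` in different
    -- colours.
    ... | inj₁ (y , y∈S , q<) = record
      { distinct = λ ()
      ; hub      = y
      ; rim      = neighbours α R y T
      ; large    = <⇒≤ q<
      ; clique   = AllPairs.filter⁺ _ clT
      ; spokes   = λ z∈ → let z∈T , eq = ∈-filter⁻ _ {xs = T} z∈ in
                          nbhd-disjoint (S⊆ y∈S) (T⊆ z∈T) , eq
      }
    ... | inj₂ (z , z∈T , q<) = record
      { distinct = λ ()
      ; hub      = z
      ; rim      = neighbours α B z S
      ; large    = <⇒≤ q<
      ; clique   = AllPairs.filter⁺ _ clS
      ; spokes   = λ y∈ → let y∈S , eq = ∈-filter⁻ _ {xs = S} y∈ in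
                          ≢-sym (nbhd-disjoint (S⊆ y∈S) (T⊆ z∈T)) , eq
      }

-- Edges at a vertex.

edge? : (G : Graph n) → Decidable (λ ((i , j) : Fin n × Fin n) → i <ᶠ j × Adj G i j)
edge? G (i , j) = (i <?ᶠ j) ×-dec adj? G i j

∈-edges⁺ : (G : Graph n) → ∀ {i j} → i <ᶠ j → Adj G i j → (i , j) ∈ edges G
∈-edges⁺ G i<j adj = ∈-filter⁺ (edge? G) (∈-cartesianProduct⁺ (∈-allFin _) (∈-allFin _)) (i<j , adj)

∈-edges⁻ : (G : Graph n) → ∀ {i j} → (i , j) ∈ edges G → i <ᶠ j × Adj G i j
∈-edges⁻ {n} G e∈ = proj₂ (∈-filter⁻ (edge? G) {xs = cartesianProduct (allFin n) (allFin n)} e∈)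

edges! : (G : Graph n) → Unique (edges G)
edges! {n} G = Unique.filter⁺ _ (Unique.cartesianProduct⁺ (Unique.allFin⁺ n) (Unique.allFin⁺ n))

-- Follows the convention of `edges`, so that neighbours of `v` map to listed edges.
ordered : Fin n → Fin n → Fin n × Fin n
ordered v u with v <?ᶠ u
... | yes _ = v , u
... | no  _ = u , v

ordered-injective : ∀ (v : Fin n) {u w} → ordered v u ≡ ordered v w → u ≡ w
ordered-injective v {u} {w} eq with v <?ᶠ u | v <?ᶠ w
... | yes _   | yes _   = cong proj₂ eq
... | yes v<u | no _    = contradiction (cong proj₂ eq) (≢-sym (λ v≡u → <ᶠ-irrefl v≡u v<u))
... | no _    | yes v<w = contradiction (cong proj₂ eq) (λ v≡w → <ᶠ-irrefl v≡w v<w)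
... | no _    | no _    = cong proj₁ eq

ordered-< : ∀ {v u : Fin n} → v <ᶠ u → ordered v u ≡ (v , u)
ordered-< {v = v} {u} v<u with v <?ᶠ u
... | yes _  = refl
... | no v≮u = contradiction v<u v≮u

ordered-> : ∀ {v u : Fin n} → u <ᶠ v → ordered v u ≡ (u , v)
ordered-> {v = v} {u} u<v with v <?ᶠ u
... | yes v<u = contradiction v<u (<ᶠ-asym u<v)
... | no _    = refl

module _ (G : Graph n) (v : Fin n) where

  -- By the hypotheses the edges satisfying `P` are those at `v`, and `ordered v` matches them with
  -- the neighbours of `v`. Neither list repeats an entry, so mutual inclusion gives equal lengths.
  degree-as-edges : {P : Pred (Fin n × Fin n) 0ℓ} (P? : Decidable P) →
    (∀ {i j} → (i , j) ∈ edges G → P (i , j) → i ≡ v ⊎ j ≡ v) →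
    (∀ {i j} → (i , j) ∈ edges G → i ≡ v ⊎ j ≡ v → P (i , j)) →
    length (filter P? (edges G)) ≡ degree G v
  degree-as-edges P? P⇒v v⇒P = ≤-antisym
    (≤-trans (⊆⇒length≤ (Unique.filter⁺ P? (edges! G)) from-edges) (≤-reflexive (length-map _ N)))
    (≤-trans (≤-reflexive (sym (length-map (ordered v) N)))
             (⊆⇒length≤ (Unique.map⁺ (ordered-injective v) (Unique.filter⁺ _ (Unique.allFin⁺ n))) to-edges))
    where
    N = filter (adj? G v) (allFin n)

    ∈-N : ∀ {u} → Adj G v u → ordered v u ∈ map (ordered v) N
    ∈-N {u} adj = ∈-map⁺ (ordered v) (∈-filter⁺ (adj? G v) (∈-allFin u) adj)

    from-edges : filter P? (edges G) ⊆ map (ordered v) N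
    from-edges e∈ with ∈-filter⁻ P? {xs = edges G} e∈
    ... | e∈G , p with ∈-edges⁻ G e∈G | P⇒v e∈G p
    ...   | i<j , adj | inj₁ refl = subst (_∈ map (ordered v) N) (ordered-< i<j) (∈-N adj)
    ...   | i<j , adj | inj₂ refl = subst (_∈ map (ordered v) N) (ordered-> i<j) (∈-N (symm G adj))

    to-edges : map (ordered v) N ⊆ filter P? (edges G)
    to-edges e∈ with ∈-map⁻ (ordered v) {xs = N} e∈
    ... | u , u∈ , refl with proj₂ (∈-filter⁻ (adj? G v) {xs = allFin n} u∈) | <ᶠ-cmp v u
    ...   | adj | tri< v<u _ _ rewrite ordered-< v<u =
      let e∈G = ∈-edges⁺ G v<u adj in ∈-filter⁺ P? e∈G (v⇒P e∈G (inj₁ refl))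
    ...   | adj | tri≈ _ v≡u _ = ⊥-elim (irrefl G v≡u adj)
    ...   | adj | tri> _ _ u<v rewrite ordered-> u<v =
      let e∈G = ∈-edges⁺ G u<v (symm G adj) in ∈-filter⁺ P? e∈G (v⇒P e∈G (inj₂ refl))

-- Placing the graph on a fan.

module _ {k} (G : Graph (suc k)) (v : Fin (suc k)) (α : Colouring n) (F : Fan α k) where
  open Fan F

  -- `punchOut` closes the gap left by `v`, so the other `k` vertices occupy the first `k` positions
  -- of the rim.
  rimAt : ∀ {i} → v ≢ i → Fin n
  rimAt v≢i = lookup rim (inject≤ (punchOut v≢i) large)

  hub-rimAt : ∀ {i} (v≢i : v ≢ i) → hub ≢ rimAt v≢i × colour α hub (rimAt v≢i) ≡ spokeColour
  hub-rimAt v≢i = spokes (∈-lookup _)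

  rimAt-rimAt : ∀ {i j} (v≢i : v ≢ i) (v≢j : v ≢ j) → i ≢ j →
                rimAt v≢i ≢ rimAt v≢j × colour α (rimAt v≢i) (rimAt v≢j) ≡ rimColour
  rimAt-rimAt v≢i v≢j i≢j = lookup-AllPairs
    (λ (x≢y , eq) → ≢-sym x≢y , trans (colour-symm α _ _) eq) clique
    (i≢j ∘ punchOut-injective v≢i v≢j ∘ inject≤-injective _ _ _ _)

  place : Fin (suc k) → Fin n
  place i with v ≟ i
  ... | yes _  = hub
  ... | no v≢i = rimAt v≢i

  -- Serves twice: for injectivity by contraposition, and for `preserves` because adjacency in
  -- `complete n` is inequality.
  place-distinct : ∀ {i j} → i ≢ j → place i ≢ place j
  place-distinct {i} {j} i≢j with v ≟ i | v ≟ j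
  ... | yes refl | yes refl = contradiction refl i≢j
  ... | yes _    | no v≢j   = proj₁ (hub-rimAt v≢j)
  ... | no v≢i   | yes _    = ≢-sym (proj₁ (hub-rimAt v≢i))
  ... | no v≢i   | no v≢j   = proj₁ (rimAt-rimAt v≢i v≢j i≢j)

  copy : Copy G (complete n)
  copy = record
    { embed     = place
    ; injective = λ {i} {j} → place-injective i j
    ; preserves = λ adj → place-distinct (λ i≡j → irrefl G i≡j adj)
    }
    where
    place-injective : ∀ i j → place i ≡ place j → i ≡ j
    place-injective i j eq with i ≟ j
    ... | yes i≡j = i≡j
    ... | no  i≢j = contradiction eq (place-distinct i≢j)

  -- Two vertices other than `v` both land on the rim, where edges have `rimColour`, and `distinct`
  -- separates this from `spokeColour`.
  spoke⇒at-v : ∀ {i j} → i ≢ j → colour α (place i) (place j) ≡ spokeColour → i ≡ v ⊎ j ≡ v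
  spoke⇒at-v {i} {j} i≢j eq with v ≟ i | v ≟ j
  ... | yes v≡i | _       = inj₁ (sym v≡i)
  ... | no _    | yes v≡j = inj₂ (sym v≡j)
  ... | no v≢i  | no v≢j  =
    contradiction (trans (sym (proj₂ (rimAt-rimAt v≢i v≢j i≢j))) eq) distinct

  at-v⇒spoke : ∀ {i j} → i ≢ j → i ≡ v ⊎ j ≡ v → colour α (place i) (place j) ≡ spokeColour
  at-v⇒spoke {i} {j} i≢j at-v with v ≟ i | v ≟ j
  at-v⇒spoke i≢j _          | yes refl | yes refl = contradiction refl i≢j
  at-v⇒spoke i≢j _          | yes _    | no v≢j   = proj₂ (hub-rimAt v≢j)
  at-v⇒spoke i≢j _          | no v≢i   | yes _    = trans (colour-symm α _ _) (proj₂ (hub-rimAt v≢i))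
  at-v⇒spoke i≢j (inj₁ i≡v) | no v≢i   | no _     = contradiction (sym i≡v) v≢i
  at-v⇒spoke i≢j (inj₂ j≡v) | no _     | no v≢j   = contradiction (sym j≡v) v≢j

  spoke-class : copyClassSize α copy spokeColour ≡ degree G v
  spoke-class = degree-as-edges G v _
    (λ e∈ → spoke⇒at-v (endpoints-distinct e∈)) (λ e∈ → at-v⇒spoke (endpoints-distinct e∈))
    where
    endpoints-distinct : ∀ {i j} → (i , j) ∈ edges G → i ≢ j
    endpoints-distinct e∈ i≡j = <ᶠ-irrefl i≡j (proj₁ (∈-edges⁻ G e∈))

  -- The two classes add up to twice the degree of `v` and the spoke class has exactly that degree,
  -- so they are equal. The spoke colour may be either one, hence the cases of `equal`.
  copy-balanced : 2 * degree G v ≡ size G → Balanced α copy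
  copy-balanced half = ≤-trans (≤-reflexive (m≡n⇒∣m-n∣≡0 (equal spokeColour spoke-class))) z≤n
    where
    total : copyClassSize α copy R + copyClassSize α copy B ≡ degree G v + degree G v
    total = trans (length-by-colour (λ (i , j) → colour α (place i) (place j)) (edges G))
                  (trans (sym half) (cong (degree G v +_) (+-identityʳ _)))

    equal : ∀ c → copyClassSize α copy c ≡ degree G v →
            copyClassSize α copy R ≡ copyClassSize α copy B
    equal R eq = equal-halves total (inj₁ eq)
    equal B eq = equal-halves total (inj₂ eq)

-- Arithmetic for the choice of `m`.

2*[1+n]C2≡[1+n]*n : ∀ n → 2 * (suc n C 2) ≡ suc n * n
2*[1+n]C2≡[1+n]*n zero    = refl
2*[1+n]C2≡[1+n]*n (suc n) = begin
  2 * (suc (suc n) C 2)                 ≡⟨ cong (2 *_) (nCk+nC[k+1]≡[n+1]C[k+1] (suc n) 1) ⟨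
  2 * (suc n C 1 + suc n C 2)           ≡⟨ *-distribˡ-+ 2 (suc n C 1) _ ⟩
  2 * (suc n C 1) + 2 * (suc n C 2)     ≡⟨ cong₂ (λ a b → 2 * a + b) (nC1≡n (suc n)) (2*[1+n]C2≡[1+n]*n n) ⟩
  2 * suc n + suc n * n                 ≡⟨ shuffle n ⟩
  suc (suc n) * suc n                   ∎
  where
  open ≡-Reasoning
  shuffle : ∀ n → 2 * suc n + suc n * n ≡ suc (suc n) * suc n
  shuffle = solve-∀

-- For N vertices and m = 3rN it suffices that 4(m + 1) ≤ N(N - 1). The left side is 12rN + 4 ≤
-- N(12r + 4), so N ≥ 12r + 5 is enough.
3rn<half : ∀ r n → n ≥ 12 * r + 5 → n * r + (2 * r) * n < ⌊ n C 2 /2⌋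
3rn<half r zero    n≥ rewrite +-comm (12 * r) 5 with () ← n≥
3rn<half r (suc n) n≥ = begin-strict
  m                       <⟨ ≤-refl ⟩
  suc m                   ≡⟨ n≡⌊n+n/2⌋ (suc m) ⟩
  ⌊ suc m + suc m /2⌋     ≤⟨ ⌊n/2⌋-mono (*-cancelˡ-≤ 2 doubled) ⟩
  ⌊ suc n C 2 /2⌋         ∎
  where
  open ≤-Reasoning
  m = suc n * r + (2 * r) * suc n

  expand : ∀ r n → 2 * (suc (suc n * r + (2 * r) * suc n) + suc (suc n * r + (2 * r) * suc n))
                   ≡ suc n * (12 * r) + 4
  expand = solve-∀

  collect : ∀ r n → suc n * (12 * r) + suc n * 4 ≡ suc n * (12 * r + 4)
  collect = solve-∀

  doubled : 2 * (suc m + suc m) ≤ 2 * (suc n C 2)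
  doubled = begin
    2 * (suc m + suc m)               ≡⟨ expand r n ⟩
    suc n * (12 * r) + 4              ≤⟨ +-monoʳ-≤ (suc n * (12 * r)) (m≤m+n 4 (n * 4)) ⟩
    suc n * (12 * r) + suc n * 4      ≡⟨ collect r n ⟩
    suc n * (12 * r + 4)              ≤⟨ *-monoʳ-≤ (suc n) (s≤s⁻¹ (≤-trans (≤-reflexive (sym (+-suc (12 * r) 4))) n≥)) ⟩
    suc n * n                         ≡⟨ 2*[1+n]C2≡[1+n]*n n ⟨
    2 * (suc n C 2)                   ∎

proposition5 : ∀ {k : ℕ} (G : Graph k) →
    (∃[ v ] 2 * degree G v ≡ size G) →
    Balanceable G
-- The vertex `v` rules out the empty graph; the fan needs `k` rim vertices, one for each vertex
-- besides `v`.
proposition5 {suc k} G (v , half) = 12 * r + 5 , λ n n≥ →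
  n * r + (2 * r) * n , 3rn<half r n n≥ , λ α largeR largeB →
    let x , rich = rich-in-both α r largeR largeB
        F        = fan-at-rich α k x rich
    in  copy G v α F , copy-balanced G v α F half
  where
  r = threshold k
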